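{- Let $F$ be a triple system with $f$ vertices and $v \in V(F)$. Then $$r(F(v), K_t^3) < \bigl(r(F, K_t^3)\bigr)^{f}.$$
   Context: A triple system ($3$-graph) $H$ with vertex set $V(H)$ is a collection of $3$-element subsets of $V(H)$, called edges. $K_n^3$ is the complete $3$-graph on $n$ vertices (all $3$-subsets are edges). For $3$-graphs $F, G$, the Ramsey number $r(F,G)$ is the minimum $n$ such that every red/blue coloring of the edges of $K_n^3$ contains a copy of $F$ all of whose edges are red, or a copy of $G$ all of whose edges are blue. For a triple system $F$ and $v \in V(F)$, $F(v)$ denotes the triple system obtained from $F$ by replacing $v$ with two clones $v_1, v_2$: its vertex set is $(V(F) \setminus \{v\}) \cup \{v_1, v_2\}$ with $v_1 \ne v_2$ new vertices, and its edges are the edges of $F$ not containing $v$, together with the triples $(e \setminus \{v\}) \cup \{v_1\}$ and $(e \setminus \{v\}) \cup \{v_2\}$ for each edge $e$ of $F$ containing $v$. In particular no edge of $F(v)$ contains both $v_1$ and $v_2$.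
   Formalization: The formal theorem assumes f ≥ 2 and t ≥ 2; the strict inequality fails in all excluded cases (t = 1 gives 1 < 1, t = 0 gives 0 < 0, and f = 1 with t ≥ 2 gives 2 < 1). -}

module Defs where

open import Data.Fin using (Fin; zero; suc)
open import Data.Fin.Properties using (any?) renaming (_≟_ to _≟ᶠ_)
open import Data.Fin.Subset
  using (Subset; inside; outside; _∈_; _∉_; _-_; ∣_∣)
open import Data.Fin.Subset.Properties using (_∈?_; anySubset?; p─⊥≡p)
open import Data.Nat using (ℕ; suc; _≤_)
open import Data.Nat.Properties using (≡-irrelevant) renaming (_≟_ to _≟ⁿ_)
open import Data.Bool.Properties using () renaming (_≟_ to _≟ᵇ_)
open import Data.Product using (Σ-syntax; ∃; _×_; _,_; proj₁)
open import Data.Sum using (_⊎_)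
open import Data.Vec using (_∷_; here; there; tabulate)
open import Data.Vec.Properties using (≡-dec)
open import Function using (_↣_; Injection)
open import Level using (0ℓ)
open import Relation.Binary.PropositionalEquality
  using (_≡_; refl; trans; cong)
open import Relation.Binary.Definitions using (DecidableEquality)
open import Relation.Nullary using (yes; no; does)
open import Relation.Nullary.Decidable using (_×-dec_; map′)
open import Relation.Unary using (Pred; Decidable)

-- A 3-graph with vertex set Fin n.  Decidability of `Edge` makes it a genuine
-- (finite) collection of subsets.
record TripleSystem (n : ℕ) : Set₁ where
  field
    Edge    : Pred (Subset n) 0ℓ
    edge?   : Decidable Edge
    uniform : ∀ {e} → Edge e → ∣ e ∣ ≡ 3

open TripleSystem public

K³ : ∀ n → TripleSystem n
K³ n .Edge e    = ∣ e ∣ ≡ 3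
K³ n .edge? e   = ∣ e ∣ ≟ⁿ 3
K³ n .uniform p = p

image : ∀ {m n} → (Fin m → Fin n) → Subset m → Subset n
image φ p = tabulate λ y → does (any? λ x → (x ∈? p) ×-dec (φ x ≟ᶠ y))

-- H contains a (not necessarily induced) copy of F.
_⊑_ : ∀ {m n} → TripleSystem m → TripleSystem n → Set
_⊑_ {m} {n} F H =
  Σ[ φ ∈ (Fin m ↣ Fin n) ] (∀ {e} → Edge F e → Edge H (image (Injection.to φ) e))

data Colour : Set where
  red blue : Colour

_≟ᶜ_ : DecidableEquality Colour
red  ≟ᶜ red  = yes refl
red  ≟ᶜ blue = no λ ()
blue ≟ᶜ red  = no λ ()
blue ≟ᶜ blue = yes refl

Colouring : ℕ → Set
Colouring n = ∃ (Edge (K³ n)) → Colour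

colourClass : ∀ {n} → Colouring n → Colour → TripleSystem n
colourClass {n} χ c .Edge e = Σ[ k ∈ Edge (K³ n) e ] χ (e , k) ≡ c
colourClass {n} χ c .edge? e with edge? (K³ n) e
... | no ¬k = no λ (k , _) → ¬k k
... | yes k =
  map′ (k ,_)
       (λ (k′ , q) → trans (cong (λ z → χ (e , z)) (≡-irrelevant k k′)) q)
       (χ (e , k) ≟ᶜ c)
colourClass χ c .uniform = proj₁

Arrows : ∀ {a b} → TripleSystem a → TripleSystem b → ℕ → Set
Arrows F G n = (χ : Colouring n) → (F ⊑ colourClass χ red) ⊎ (G ⊑ colourClass χ blue)

-- IsRamseyNumber F G n says that r(F,G) exists and equals n.
IsRamseyNumber : ∀ {a b} → TripleSystem a → TripleSystem b → ℕ → Set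
IsRamseyNumber F G n = Arrows F G n × (∀ m → Arrows F G m → n ≤ m)

-- The edges of F(v).  The vertex set is Fin (suc f): the clones of v are
-- v₁ = zero and v₂ = suc v, and any other vertex u of F becomes suc u.  Thus
-- `outside ∷ e` is e itself for v ∉ e, and (e ∖ {v}) ∪ {v₂} for v ∈ e, while
-- `inside ∷ (e - v)` is (e ∖ {v}) ∪ {v₁}.
data CloneEdge {f} (F : TripleSystem f) (v : Fin f) : Pred (Subset (suc f)) 0ℓ where
  keep   : ∀ {e} → Edge F e → v ∉ e → CloneEdge F v (outside ∷ e)
  clone₁ : ∀ {e} → Edge F e → v ∈ e → CloneEdge F v (inside ∷ (e - v))
  clone₂ : ∀ {e} → Edge F e → v ∈ e → CloneEdge F v (outside ∷ e)

private
  ∣p-x∣+1≡∣p∣ : ∀ {n} {p : Subset n} {x} → x ∈ p → suc ∣ p - x ∣ ≡ ∣ p ∣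
  ∣p-x∣+1≡∣p∣ {p = _ ∷ p} here = cong (λ q → suc ∣ q ∣) (p─⊥≡p p)
  ∣p-x∣+1≡∣p∣ {p = inside  ∷ _} (there x∈p) = cong suc (∣p-x∣+1≡∣p∣ x∈p)
  ∣p-x∣+1≡∣p∣ {p = outside ∷ _} (there x∈p) = ∣p-x∣+1≡∣p∣ x∈p

  cloneEdge? : ∀ {f} (F : TripleSystem f) v → Decidable (CloneEdge F v)
  cloneEdge? F v (outside ∷ e) = map′ to from (edge? F e)
    where
    to : Edge F e → CloneEdge F v (outside ∷ e)
    to h with v ∈? e
    ... | yes v∈e = clone₂ h v∈e
    ... | no  v∉e = keep h v∉e
    from : CloneEdge F v (outside ∷ e) → Edge F e
    from (keep h _)   = h
    from (clone₂ h _) = h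
  cloneEdge? F v (inside ∷ d) =
    map′ (λ { (e , h , v∈e , refl) → clone₁ h v∈e })
         (λ { (clone₁ h v∈e) → _ , h , v∈e , refl })
         (anySubset? λ e → edge? F e ×-dec (v ∈? e) ×-dec ≡-dec _≟ᵇ_ (e - v) d)

clone : ∀ {f} → TripleSystem f → Fin f → TripleSystem (suc f)
clone F v .Edge  = CloneEdge F v
clone F v .edge? = cloneEdge? F v
clone F v .uniform (keep h _)     = uniform F h
clone F v .uniform (clone₁ h v∈e) = trans (∣p-x∣+1≡∣p∣ v∈e) (uniform F h)
clone F v .uniform (clone₂ h _)   = uniform F h

-- Suppose r = r(F, K_t), N = r ^ f ∸ 1 and 3 ≤ f.  If a colouring of K_N has no
-- blue K_t, then every injection g : Fin r → Fin N pulls it back to a colouring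
-- of K_r with a red copy φ of F.  There are N P′ r injections g, but only
-- (N P′ (r ∸ 1)) * (r P′ f) pairs (g restricted to the complement of φ v , φ),
-- which is fewer because r P′ f + r < r ^ f.  Two injections with the same pair
-- give two red copies of F which differ exactly at v, that is, a red copy of F(v).
-- For f = 2 the graph F(v) has no edges, and N = 3 suffices.  The least N that
-- arrows exists constructively because a finite search decides arrowing.
module Submission where

open import Defs
open import Data.Fin using (Fin; zero; suc; combine; punchIn; punchOut; inject≤) renaming (_<_ to _<ᶠ_)
open import Data.Fin.Properties
  using ( any?; pigeonhole; combine-injective; combine-surjective; injective⇒≤; inject≤-injective
        ; suc-injective; 0≢1+n; <⇒≢; punchIn-injective; punchInᵢ≢i; punchIn-punchOut
        ; punchOut-injective; nonZeroIndex; sequence)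
  renaming (_≟_ to _≟ᶠ_)
open import Data.Fin.Subset using (Subset; inside; outside; _∈_; _⊆_; _-_; ∣_∣)
open import Data.Fin.Subset.Properties
  using ( _∈?_; anySubset?; ⊆-antisym; Empty-unique; ∣⊥∣≡0; ∣p∣≤n; p─⊥≡p; p─q⊆p
        ; x∈p∧x≢y⇒x∈p-y; drop-there)
open import Data.Nat using (ℕ; zero; suc; NonZero; _+_; _*_; _∸_; _^_; _≤_; _<_; z≤n; s≤s)
open import Data.Nat.Combinatorics.Base using (_P′_)
open import Data.Nat.Combinatorics.Specification using (nP′k≡n[n∸1P′k∸1])
open import Data.Nat.Properties
  using ( ≡-irrelevant; ≤-trans; ≤-reflexive; <⇒≤; ≤-<-trans; <⇒≱; n<1+n
        ; m≤m+n; m≤n+m; m≤n*m; m∸n≤m; ∸-monoˡ-≤; ∸-monoʳ-<; 0∸n≡0; ∸-+-assoc; m+n≤o⇒m≤o∸n; +-mono-≤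
        ; *-distribˡ-+; *-monoˡ-≤; *-monoʳ-<; *-comm; m^n>0; ^-monoˡ-≤
        ; module ≤-Reasoning)
open import Data.Nat.Tactic.RingSolver using (solve-∀)
open import Data.Product using (∃; ∃-syntax; _×_; _,_; proj₁; proj₂)
open import Data.Sum using (_⊎_; inj₁; inj₂; map₁; swap) renaming (map to map-⊎)
open import Data.Sum.Effectful.Left using (applicative)
open import Data.Vec using ([]; _∷_; here; there)
open import Data.Vec.Properties using (lookup∘tabulate; lookup⇒[]=; []=⇒lookup)
open import Function using (_∘_; const; _↣_; Injection; mk↣)
open import Function.Definitions using (Injective)
open import Level using (0ℓ)
open import Relation.Binary.PropositionalEquality
  using (_≡_; _≢_; _≗_; refl; sym; trans; cong; subst; module ≡-Reasoning)
open import Relation.Nullary using (¬_; Dec; yes; no; does; contradiction)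
open import Relation.Nullary.Decidable
  using (map′; _×-dec_; _⊎-dec_; _→-dec_; ¬?; dec-true; decidable-stable)

open Injection using (to; injective)

private
  variable
    l m n k f t : ℕ

_⊙_ : Fin m ↣ Fin n → Fin l ↣ Fin m → Fin l ↣ Fin n
g ⊙ h = mk↣ {to = to g ∘ to h} (injective h ∘ injective g)

-- Images of subsets

∈-image⁺ : ∀ (φ : Fin m → Fin n) {p x} → x ∈ p → φ x ∈ image φ p
∈-image⁺ φ {p} {x} x∈p =
  lookup⇒[]= (φ x) _ (trans (lookup∘tabulate _ (φ x))
    (dec-true (any? λ z → (z ∈? p) ×-dec (φ z ≟ᶠ φ x)) (x , x∈p , refl)))

∈-image⁻ : ∀ (φ : Fin m → Fin n) {p y} → y ∈ image φ p → ∃[ x ] (x ∈ p × φ x ≡ y)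
∈-image⁻ φ {p} {y} y∈
  with any? (λ z → (z ∈? p) ×-dec (φ z ≟ᶠ y))
     | trans (sym (lookup∘tabulate (λ w → does (any? λ z → (z ∈? p) ×-dec (φ z ≟ᶠ w))) y))
             ([]=⇒lookup y∈)
... | yes h | _  = h
... | no  _ | ()

image-⊆ : ∀ (φ : Fin m → Fin n) {p q} → (∀ {x} → x ∈ p → φ x ∈ q) → image φ p ⊆ q
image-⊆ φ h y∈ with ∈-image⁻ φ y∈
... | _ , x∈p , refl = h x∈p

image-≡ : ∀ (φ : Fin l → Fin n) (ψ : Fin m → Fin n) {p q} →
          (∀ {x} → x ∈ p → φ x ∈ image ψ q) → (∀ {x} → x ∈ q → ψ x ∈ image φ p) →
          image φ p ≡ image ψ q
image-≡ φ ψ h h′ = ⊆-antisym (image-⊆ φ h) (image-⊆ ψ h′)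

image-cong : ∀ {φ ψ : Fin m → Fin n} → φ ≗ ψ → ∀ p → image φ p ≡ image ψ p
image-cong {φ = φ} {ψ} φ≗ψ p =
  image-≡ φ ψ (λ {x} x∈p → subst (_∈ image ψ p) (sym (φ≗ψ x)) (∈-image⁺ ψ x∈p))
              (λ {x} x∈p → subst (_∈ image φ p) (φ≗ψ x) (∈-image⁺ φ x∈p))

image-∘ : ∀ (φ : Fin m → Fin n) (ψ : Fin l → Fin m) p → image φ (image ψ p) ≡ image (φ ∘ ψ) p
image-∘ φ ψ p = ⊆-antisym
  (image-⊆ φ λ x∈ → case-image (∈-image⁻ ψ x∈))
  (image-⊆ (φ ∘ ψ) (∈-image⁺ φ ∘ ∈-image⁺ ψ))
  where
  case-image : ∀ {x} → ∃[ z ] (z ∈ p × ψ z ≡ x) → φ x ∈ image (φ ∘ ψ) p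
  case-image (_ , z∈p , refl) = ∈-image⁺ (φ ∘ ψ) z∈p

image-outside : ∀ (φ : Fin (suc m) → Fin n) p → image φ (outside ∷ p) ≡ image (φ ∘ suc) p
image-outside φ p =
  image-≡ φ (φ ∘ suc) {outside ∷ p} (λ { (there x∈p) → ∈-image⁺ (φ ∘ suc) x∈p }) (∈-image⁺ φ {outside ∷ p} ∘ there)

x∉p-x : ∀ (p : Subset n) x → ¬ x ∈ p - x
x∉p-x (_ ∷ _) zero    ()
x∉p-x (_ ∷ p) (suc x) x∈ = x∉p-x p x (drop-there x∈)

∣p-x∣+1≡∣p∣ : ∀ {p : Subset n} {x} → x ∈ p → suc ∣ p - x ∣ ≡ ∣ p ∣
∣p-x∣+1≡∣p∣ {p = _ ∷ p}       here        = cong (λ q → suc ∣ q ∣) (p─⊥≡p p)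
∣p-x∣+1≡∣p∣ {p = inside  ∷ _} (there x∈p) = cong suc (∣p-x∣+1≡∣p∣ x∈p)
∣p-x∣+1≡∣p∣ {p = outside ∷ _} (there x∈p) = ∣p-x∣+1≡∣p∣ x∈p

-- Peels the head off an image, for the induction in `∣image∣`. Injectivity keeps `φ zero` out of
-- the image of the tail.
image-inside-minus : ∀ (φ : Fin (suc m) → Fin n) → Injective _≡_ _≡_ φ → ∀ p →
                     image φ (inside ∷ p) - φ zero ≡ image (φ ∘ suc) p
image-inside-minus φ inj p = ⊆-antisym ⊆₁
  (image-⊆ (φ ∘ suc) λ x∈p → x∈p∧x≢y⇒x∈p-y (∈-image⁺ φ {inside ∷ p} (there x∈p)) (0≢1+n ∘ sym ∘ inj))
  where
  ⊆₁ : image φ (inside ∷ p) - φ zero ⊆ image (φ ∘ suc) p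
  ⊆₁ y∈ with ∈-image⁻ φ (p─q⊆p (image φ (inside ∷ p)) _ y∈)
  ... | zero  , _         , refl = contradiction y∈ (x∉p-x (image φ (inside ∷ p)) (φ zero))
  ... | suc x , there x∈p , refl = ∈-image⁺ (φ ∘ suc) x∈p

∣image∣ : ∀ (φ : Fin m → Fin n) → Injective _≡_ _≡_ φ → ∀ p → ∣ image φ p ∣ ≡ ∣ p ∣
∣image∣ {n = n} φ inj [] =
  trans (cong ∣_∣ (Empty-unique λ (_ , y∈) → contradiction (∈-image⁻ φ {[]} y∈) λ { (_ , () , _) })) (∣⊥∣≡0 n)
∣image∣ φ inj (outside ∷ p) =
  trans (cong ∣_∣ (image-outside φ p)) (∣image∣ (φ ∘ suc) (suc-injective ∘ inj) p)
∣image∣ φ inj (inside ∷ p) = begin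
  ∣ image φ (inside ∷ p) ∣                ≡⟨ ∣p-x∣+1≡∣p∣ (∈-image⁺ φ {inside ∷ p} here) ⟨
  suc ∣ image φ (inside ∷ p) - φ zero ∣   ≡⟨ cong (suc ∘ ∣_∣) (image-inside-minus φ inj p) ⟩
  suc ∣ image (φ ∘ suc) p ∣               ≡⟨ cong suc (∣image∣ (φ ∘ suc) (suc-injective ∘ inj) p) ⟩
  suc ∣ p ∣                               ∎
  where open ≡-Reasoning

-- Enumerating injections

-- A bijection between `Fin N` and the injections, taken up to pointwise equality.
record Enumeration (m n N : ℕ) : Set where
  field
    at          : Fin N → Fin m ↣ Fin n
    at-distinct : ∀ {c d} → to (at c) ≗ to (at d) → c ≡ d
    index       : Fin m ↣ Fin n → Fin N
    at-index    : ∀ g → to (at (index g)) ≗ to g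

  index-injective : ∀ {g h} → index g ≡ index h → to g ≗ to h
  index-injective {g} {h} eq x =
    trans (sym (at-index g x)) (trans (cong (λ c → to (at c) x) eq) (at-index h x))

module _ (E : Enumeration m n k) where
  open Enumeration E

  private
    -- An injection from `Fin (suc m)` amounts to its value `a` at `zero` and an injection into the
    -- complement of `a`, which `punchIn a` identifies with `Fin n`.
    cons : Fin (suc n) → Fin m ↣ Fin n → Fin (suc m) → Fin (suc n)
    cons a g zero    = a
    cons a g (suc x) = punchIn a (to g x)

    cons-injective : ∀ a g → Injective _≡_ _≡_ (cons a g)
    cons-injective a g {zero}  {zero}  _  = refl
    cons-injective a g {zero}  {suc _} eq = contradiction (sym eq) (punchInᵢ≢i a _)
    cons-injective a g {suc _} {zero}  eq = contradiction eq (punchInᵢ≢i a _)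
    cons-injective a g {suc _} {suc _} eq = cong suc (injective g (punchIn-injective a _ _ eq))

    split : Fin (suc n * k) → Fin (suc n) × Fin k
    split c = let a , d , _ = combine-surjective {suc n} {k} c in a , d

    at′ : Fin (suc n * k) → Fin (suc m) ↣ Fin (suc n)
    at′ c = mk↣ (cons-injective (proj₁ (split c)) (at (proj₂ (split c))))

    combine-split : ∀ c → combine (proj₁ (split c)) (proj₂ (split c)) ≡ c
    combine-split c = proj₂ (proj₂ (combine-surjective {suc n} {k} c))

    cons-distinct : ∀ {a b c d} → cons a (at c) ≗ cons b (at d) → combine a c ≡ combine b d
    cons-distinct {a} eq with eq zero
    ... | refl = cong (combine a) (at-distinct λ x → punchIn-injective a _ _ (eq (suc x)))

    at′-distinct : ∀ {c d} → to (at′ c) ≗ to (at′ d) → c ≡ d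
    at′-distinct {c} {d} eq =
      trans (sym (combine-split c)) (trans (cons-distinct eq) (combine-split d))

    head≢ : ∀ (g : Fin (suc m) ↣ Fin (suc n)) x → to g zero ≢ to g (suc x)
    head≢ g _ = 0≢1+n ∘ injective g

    tail : Fin (suc m) ↣ Fin (suc n) → Fin m ↣ Fin n
    tail g = mk↣ {to = λ x → punchOut (head≢ g x)}
      (suc-injective ∘ injective g ∘ punchOut-injective (head≢ g _) (head≢ g _))

    index′ : Fin (suc m) ↣ Fin (suc n) → Fin (suc n * k)
    index′ g = combine (to g zero) (index (tail g))

    cons-index : ∀ g {a c} → combine a c ≡ index′ g → cons a (at c) ≗ to g
    cons-index g {a} {c} eq x with combine-injective a c (to g zero) (index (tail g)) eq
    cons-index g eq zero    | refl , refl = refl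
    cons-index g eq (suc x) | refl , refl =
      trans (cong (punchIn (to g zero)) (at-index (tail g) x)) (punchIn-punchOut (head≢ g x))

    at′-index′ : ∀ g → to (at′ (index′ g)) ≗ to g
    at′-index′ g = cons-index g (combine-split (index′ g))

  cons-enumeration : Enumeration (suc m) (suc n) (suc n * k)
  cons-enumeration = record
    { at = at′ ; at-distinct = at′-distinct ; index = index′ ; at-index = at′-index′ }

injections : ∀ m n → Enumeration m n (n P′ m)
injections zero n = record
  { at          = λ _ → mk↣ {to = λ ()} λ {x} → contradiction x λ ()
  ; at-distinct = λ { {zero} {zero} _ → refl }
  ; index       = λ _ → zero
  ; at-index    = λ _ ()
  }
-- `0 P′ suc m` unfolds to `(0 ∸ m) * (0 P′ m)`, whose first factor vanishes.
injections (suc m) zero = subst (Enumeration (suc m) 0) (sym (cong (_* (0 P′ m)) (0∸n≡0 m))) (record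
  { at          = λ ()
  ; at-distinct = λ { {()} }
  ; index       = λ g → to g zero
  ; at-index    = λ g → contradiction (to g zero) λ ()
  })
injections (suc m) (suc n) =
  -- `_P′_` recurses on the last factor of the falling factorial, while `cons-enumeration` splits
  -- off the first.
  subst (Enumeration (suc m) (suc n)) (sym (nP′k≡n[n∸1P′k∸1] (suc n) (suc m)))
    (cons-enumeration (injections m n))

-- Finding a clone

copy-mono : ∀ (F : TripleSystem m) (G H : TripleSystem n) →
            (∀ {e} → Edge G e → Edge H e) → F ⊑ G → F ⊑ H
copy-mono F G H h (φ , edges) = φ , h ∘ edges

-- The two copies share every vertex except the image of `v`. The edges avoiding `v₁` come from `α`,
-- those through `v₁` from `β`.
clone-⊑ : ∀ (F : TripleSystem f) (v : Fin f) (H : TripleSystem n) (α β : Fin f ↣ Fin n) →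
          (∀ {e} → Edge F e → Edge H (image (to α) e)) →
          (∀ {e} → Edge F e → Edge H (image (to β) e)) →
          (∀ u → v ≢ u → to α u ≡ to β u) → to α v ≢ to β v → clone F v ⊑ H
clone-⊑ {f} {n} F v H α β edgeα edgeβ agree differ = mk↣ {to = φ} φ-injective , edge
  where
  φ : Fin (suc f) → Fin n
  φ zero    = to β v
  φ (suc u) = to α u

  head≢ : ∀ u → to β v ≢ to α u
  head≢ u eq with v ≟ᶠ u
  ... | yes refl = differ (sym eq)
  ... | no  v≢u  = v≢u (injective β (trans eq (agree u v≢u)))

  φ-injective : Injective _≡_ _≡_ φ
  φ-injective {zero}  {zero}  _  = refl
  φ-injective {zero}  {suc u} eq = contradiction eq (head≢ u)
  φ-injective {suc u} {zero}  eq = contradiction (sym eq) (head≢ u)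
  φ-injective {suc u} {suc w} eq = cong suc (injective α eq)

  first-clone : ∀ {e} → v ∈ e → image (to β) e ≡ image φ (inside ∷ (e - v))
  first-clone {e} v∈e = image-≡ (to β) φ ⊆₁ ⊆₂
    where
    ⊆₁ : ∀ {u} → u ∈ e → to β u ∈ image φ (inside ∷ (e - v))
    ⊆₁ {u} u∈e with v ≟ᶠ u
    ... | yes refl = ∈-image⁺ φ {inside ∷ (e - v)} here
    ... | no  v≢u  = subst (_∈ image φ (inside ∷ (e - v))) (agree u v≢u)
                       (∈-image⁺ φ (there (x∈p∧x≢y⇒x∈p-y u∈e (v≢u ∘ sym))))
    ⊆₂ : ∀ {x} → x ∈ inside ∷ (e - v) → φ x ∈ image (to β) e
    ⊆₂ here = ∈-image⁺ (to β) v∈e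
    ⊆₂ {suc u} (there u∈) =
      subst (_∈ image (to β) e) (sym (agree u λ { refl → x∉p-x e v u∈ }))
        (∈-image⁺ (to β) (p─q⊆p e _ u∈))

  edge : ∀ {e} → CloneEdge F v e → Edge H (image φ e)
  edge (keep {e} h _)     = subst (Edge H) (sym (image-outside φ e)) (edgeα h)
  edge (clone₁ h v∈e)     = subst (Edge H) (first-clone v∈e) (edgeβ h)
  edge (clone₂ {e} h _)   = subst (Edge H) (sym (image-outside φ e)) (edgeα h)

pullback : Fin m ↣ Fin n → Colouring n → Colouring m
pullback g χ (e , p) = χ (image (to g) e , trans (∣image∣ (to g) (injective g) e) p)

pushforward-edge : ∀ (g : Fin m ↣ Fin n) χ c (φ : Fin l ↣ Fin m) {e} →
                   Edge (colourClass (pullback g χ) c) (image (to φ) e) →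
                   Edge (colourClass χ c) (image (to (g ⊙ φ)) e)
pushforward-edge g χ c φ {e} (_ , q) =
  subst (Edge (colourClass χ c)) (image-∘ (to g) (to φ) e) (_ , q)

punchIn-agree : ∀ {A : Set} {a b : Fin (suc n) → A} x →
                (∀ y → a (punchIn x y) ≡ b (punchIn x y)) → ∀ y → x ≢ y → a y ≡ b y
punchIn-agree {a = a} {b} x eq y x≢y =
  subst (λ z → a z ≡ b z) (punchIn-punchOut x≢y) (eq (punchOut x≢y))

-- Pigeonhole: by `few`, the injections of `suc k` points outnumber their codes, so two distinct
-- ones share a code.
arrows-clone : ∀ (F : TripleSystem f) v (G : TripleSystem t) {k n} → Arrows F G (suc k) →
               (n P′ k) * (suc k P′ f) < n P′ suc k → Arrows (clone F v) G n
arrows-clone {f} {t} F v G {k} {n} arrows few χ = map₁ red-clone outcome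
  where
  open Enumeration

  g : Fin (n P′ suc k) → Fin (suc k) ↣ Fin n
  g = at (injections (suc k) n)

  RedCopy : Fin (n P′ suc k) → Set
  RedCopy c = F ⊑ colourClass (pullback (g c) χ) red

  attempt : ∀ c → G ⊑ colourClass χ blue ⊎ RedCopy c
  attempt c with arrows (pullback (g c) χ)
  ... | inj₁ copy        = inj₂ copy
  ... | inj₂ (ψ , edges) = inj₁ (g c ⊙ ψ , pushforward-edge (g c) χ blue ψ ∘ edges)

  outcome : (∀ c → RedCopy c) ⊎ G ⊑ colourClass χ blue
  -- Sequencing over the finitely many `c` stops at a blue copy if some attempt yields one, and
  -- otherwise collects all the red ones.
  outcome = swap (sequence (applicative (G ⊑ colourClass χ blue) 0ℓ) attempt)

  red-clone : (∀ c → RedCopy c) → clone F v ⊑ colourClass χ red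
  red-clone copies = found (pigeonhole few code)
    where
    φ : Fin (n P′ suc k) → Fin f ↣ Fin (suc k)
    φ c = proj₁ (copies c)

    rest : Fin (n P′ suc k) → Fin k ↣ Fin n
    -- `g c` restricted to the complement of `φ v`, with that complement reindexed by `Fin k`.
    rest c = g c ⊙ mk↣ (punchIn-injective (to (φ c) v) _ _)

    code : Fin (n P′ suc k) → Fin ((n P′ k) * (suc k P′ f))
    code c = combine (index (injections k n) (rest c)) (index (injections f (suc k)) (φ c))

    copy : ∀ c {e} → Edge F e → Edge (colourClass χ red) (image (to (g c ⊙ φ c)) e)
    copy c h = pushforward-edge (g c) χ red (φ c) (proj₂ (copies c) h)

    found : (∃[ c ] ∃[ d ] (c <ᶠ d × code c ≡ code d)) → clone F v ⊑ colourClass χ red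
    found (c , d , c<d , eq) =
      clone-⊑ F v (colourClass χ red) (g c ⊙ φ c) (g d ⊙ φ d) (copy c) (copy d)
        (λ u v≢u → trans (g-agree (to (φ c) u) (v≢u ∘ injective (φ c))) (cong (to (g d)) (φ-agree u)))
        differ
      where
      codes≡ = combine-injective (index (injections k n) (rest c)) (index (injections f (suc k)) (φ c))
                                 (index (injections k n) (rest d)) (index (injections f (suc k)) (φ d)) eq

      φ-agree : to (φ c) ≗ to (φ d)
      φ-agree = index-injective (injections f (suc k)) (proj₂ codes≡)

      g-agree : ∀ y → to (φ c) v ≢ y → to (g c) y ≡ to (g d) y
      g-agree = punchIn-agree (to (φ c) v) λ y →
        trans (index-injective (injections k n) {rest c} {rest d} (proj₁ codes≡) y)
              (cong (λ x → to (g d) (punchIn x y)) (sym (φ-agree v)))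

      -- Agreement at `v` as well would make `g c` and `g d` equal everywhere, although `c` and `d`
      -- are distinct.
      differ : to (g c ⊙ φ c) v ≢ to (g d ⊙ φ d) v
      differ gv≡ = <⇒≢ c<d (at-distinct (injections (suc k) n) g≗)
        where
        g≗ : to (g c) ≗ to (g d)
        g≗ y with to (φ c) v ≟ᶠ y
        ... | yes refl = trans gv≡ (cong (to (g d)) (sym (φ-agree v)))
        ... | no  x≢y  = g-agree y x≢y

-- Counting

-- With `r = 2 + j`, induction on the exponent from 3 upwards: a further step multiplies the falling
-- factorial by at most `r`, and `r ≤ r * r` takes care of the summand. At exponent 2 the two sides
-- would be equal.
P′-bound : ∀ j i → (2 + j) P′ (3 + i) + (2 + j) < (2 + j) ^ (3 + i)
-- The added term is `3 * r * (r - 1) - 1`, the exact gap between the two sides less one for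
-- strictness.
P′-bound j zero    = ≤-trans (m≤m+n _ (5 + 9 * j + 3 * (j * j))) (≤-reflexive (expand j))
  where
  expand : ∀ j → suc (j * (suc j * ((2 + j) * 1)) + (2 + j)) + (5 + 9 * j + 3 * (j * j)) ≡
                 (2 + j) * ((2 + j) * ((2 + j) * 1))
  expand = solve-∀
P′-bound j (suc i) = begin-strict
  (r ∸ (3 + i)) * p + r  ≤⟨ +-mono-≤ (*-monoˡ-≤ p (m∸n≤m r (3 + i))) (m≤n*m r r) ⟩
  r * p + r * r          ≡⟨ *-distribˡ-+ r p r ⟨
  r * (p + r)            <⟨ *-monoʳ-< r (P′-bound j i) ⟩
  r * r ^ (3 + i)        ∎
  where
  open ≤-Reasoning
  r = 2 + j
  p = r P′ (3 + i)

-- An injection of `k` points into `N ∸ 1` points extends to one more point in `N ∸ 1 ∸ k` ways, so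
-- it suffices that `suc k P′ f` is less than this.
few-codes : ∀ {k f N} → suc k P′ f + suc k < N → ((N ∸ 1) P′ k) * (suc k P′ f) < (N ∸ 1) P′ suc k
few-codes {k} {f} {N} bound = begin-strict
  ((N ∸ 1) P′ k) * (suc k P′ f)  <⟨ *-monoʳ-< ((N ∸ 1) P′ k) enough ⟩
  ((N ∸ 1) P′ k) * (N ∸ 1 ∸ k)   ≡⟨ *-comm ((N ∸ 1) P′ k) (N ∸ 1 ∸ k) ⟩
  (N ∸ 1 ∸ k) * ((N ∸ 1) P′ k)   ∎
  where
  open ≤-Reasoning

  enough : suc k P′ f < N ∸ 1 ∸ k
  enough = subst (suc (suc k P′ f) ≤_) (sym (∸-+-assoc N 1 k)) (m+n≤o⇒m≤o∸n _ bound)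

  k≤N∸1 : k ≤ N ∸ 1
  k≤N∸1 = ∸-monoˡ-≤ 1 (<⇒≤ (≤-<-trans (m≤n+m (suc k) _) bound))

  -- Strict monotonicity needs a positive factor. It counts injections, and `k ≤ N ∸ 1` provides
  -- one.
  instance
    P′≢0 : NonZero ((N ∸ 1) P′ k)
    P′≢0 = nonZeroIndex (Enumeration.index (injections k (N ∸ 1))
             (mk↣ {to = λ x → inject≤ x k≤N∸1} (inject≤-injective k≤N∸1 k≤N∸1 _ _)))

-- Deciding the arrow relation

allSubset? : ∀ {P : Subset n → Set} → (∀ e → Dec (P e)) → Dec (∀ e → P e)
allSubset? P? = map′ (λ h e → decidable-stable (P? e) λ ¬p → h (e , ¬p)) (λ h (e , ¬p) → ¬p (h e))
                     (¬? (anySubset? (¬? ∘ P?)))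

_⊑?_ : ∀ (F : TripleSystem m) (H : TripleSystem n) → Dec (F ⊑ H)
_⊑?_ {m} {n} F H = map′
  (λ (c , h) → at c , λ {e} → h e)
  (λ (φ , h) → index φ ,
    λ e p → subst (Edge H) (image-cong (sym ∘ at-index φ) e) (h p))
  (any? λ c → allSubset? λ e → edge? F e →-dec edge? H (image (to (at c)) e))
  where open Enumeration (injections m n)

-- Without function extensionality, P has to be assumed to respect _≗_.
allColour? : ∀ n (P : (Subset n → Colour) → Set) → (∀ {f g} → f ≗ g → P f → P g) →
             (∀ f → Dec (P f)) → Dec (∀ f → P f)
allColour? zero P resp P? =
  map′ (λ { (pr , pb) f → base f (f []) refl pr pb }) (λ h → h (const red) , h (const blue))
       (P? (const red) ×-dec P? (const blue))
  where
  base : ∀ f c → f [] ≡ c → P (const red) → P (const blue) → P f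
  base f red  eq pr pb = resp (λ { [] → sym eq }) pr
  base f blue eq pr pb = resp (λ { [] → sym eq }) pb
allColour? (suc n) P resp P? =
  map′ (λ h f → resp (λ { (outside ∷ _) → refl ; (inside ∷ _) → refl })
                     (h (f ∘ (outside ∷_)) (f ∘ (inside ∷_))))
       (λ h f g → h (glue f g))
       (allColour? n (λ f → ∀ g → P (glue f g)) (λ eq h g → resp (glue-cong eq λ _ → refl) (h g)) λ f →
         allColour? n (λ g → P (glue f g)) (λ eq → resp (glue-cong (λ _ → refl) eq)) λ g →
           P? (glue f g))
  where
  glue : (f g : Subset n → Colour) → Subset (suc n) → Colour
  glue f g (outside ∷ e) = f e
  glue f g (inside  ∷ e) = g e

  glue-cong : ∀ {f f′ g g′} → f ≗ f′ → g ≗ g′ → glue f g ≗ glue f′ g′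
  glue-cong f≗ g≗ (outside ∷ e) = f≗ e
  glue-cong f≗ g≗ (inside  ∷ e) = g≗ e

-- The search runs over colour functions on all subsets, which are simpler to enumerate; every
-- colouring is, pointwise, the restriction of one.
Arrows? : ∀ (F : TripleSystem f) (G : TripleSystem t) n → Dec (Arrows F G n)
Arrows? F G n = map′
  (λ h χ → respects (λ z → agrees χ z) (h (extend χ)))
  (λ h f → h (restrict f))
  (allColour? n (λ f → Mono (restrict f)) (λ f≗g → respects (f≗g ∘ proj₁))
    λ f → (F ⊑? colourClass (restrict f) red) ⊎-dec (G ⊑? colourClass (restrict f) blue))
  where
  Mono : Colouring n → Set
  Mono χ = (F ⊑ colourClass χ red) ⊎ (G ⊑ colourClass χ blue)

  respects : ∀ {χ χ′} → χ ≗ χ′ → Mono χ → Mono χ′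
  respects {χ} {χ′} eq = map-⊎ (copy-mono F (colourClass χ red) (colourClass χ′ red) (class red))
                               (copy-mono G (colourClass χ blue) (colourClass χ′ blue) (class blue))
    where
    class : ∀ c {e} → Edge (colourClass χ c) e → Edge (colourClass χ′ c) e
    class c (p , q) = p , trans (sym (eq (_ , p))) q

  restrict : (Subset n → Colour) → Colouring n
  restrict f (e , _) = f e

  extend : Colouring n → Subset n → Colour
  extend χ e with edge? (K³ n) e
  ... | yes p = χ (e , p)
  -- An arbitrary default: `restrict` looks only at triples.
  ... | no  _ = red

  agrees : ∀ χ → restrict (extend χ) ≗ χ
  agrees χ (e , p) with edge? (K³ n) e
  ... | yes p′ = cong (λ z → χ (e , z)) (≡-irrelevant p′ p)
  ... | no  ¬p = contradiction p ¬p

-- Existence of the Ramsey number, small cases and the theorem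

least : ∀ {P : ℕ → Set} → (∀ n → Dec (P n)) → ∀ {n} → P n → ∃[ s ] (s ≤ n × P s × (∀ m → P m → s ≤ m))
least {P} P? {n} p with P? 0 | n
... | yes p₀ | _     = 0 , z≤n , p₀ , λ _ _ → z≤n
... | no ¬p₀ | zero  = contradiction p ¬p₀
... | no ¬p₀ | suc n =
  let s , s≤n , ps , min = least (P? ∘ suc) p
  in suc s , s≤s s≤n , ps , λ { zero q → contradiction q ¬p₀ ; (suc m) q → s≤s (min m q) }

ramsey-< : ∀ (F : TripleSystem f) (G : TripleSystem t) {n N} → Arrows F G n → n < N →
           ∃[ s ] (IsRamseyNumber F G s × s < N)
ramsey-< F G arrows n<N =
  let s , s≤n , as , min = least (Arrows? F G) arrows in s , (as , min) , ≤-<-trans s≤n n<N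

-- A monochromatic copy in a single colouring already embeds at least two vertices. This excludes
-- `r ≤ 1`, where the counting bound fails.
2≤arrows : ∀ (F : TripleSystem f) (G : TripleSystem t) {n} → 2 ≤ f → 2 ≤ t → Arrows F G n → 2 ≤ n
2≤arrows F G 2≤f 2≤t arrows with arrows (const red)
... | inj₁ (φ , _) = ≤-trans 2≤f (injective⇒≤ (injective φ))
... | inj₂ (φ , _) = ≤-trans 2≤t (injective⇒≤ (injective φ))

clone-edgeless : ∀ (F : TripleSystem 2) v {e} → ¬ CloneEdge F v e
clone-edgeless F v edge = no-edge (original edge)
  where
  no-edge : ¬ ∃ (Edge F)
  no-edge (e , h) = <⇒≱ (n<1+n 2) (subst (_≤ 2) (uniform F h) (∣p∣≤n e))

  original : ∀ {e} → CloneEdge F v e → ∃ (Edge F)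
  original (keep h _)   = _ , h
  original (clone₁ h _) = _ , h
  original (clone₂ h _) = _ , h

theorem3p1 : ∀ {f t : ℕ} (F : TripleSystem f) (v : Fin f) → 2 ≤ f → 2 ≤ t →
    ∀ {r : ℕ} → IsRamseyNumber F (K³ t) r →
    ∃[ s ] (IsRamseyNumber (clone F v) (K³ t) s × s < r ^ f)
theorem3p1 {suc (suc zero)} {t} F v 2≤f 2≤t {r} (arrows , _) =
  ramsey-< (clone F v) (K³ t) {3}
    (λ χ → inj₁ (mk↣ {to = λ x → x} (λ eq → eq) , λ h → contradiction h (clone-edgeless F v)))
    -- The goal `3 < r ^ 2` is `2 ^ 2 ≤ r ^ 2`.
    (^-monoˡ-≤ 2 (2≤arrows F (K³ t) 2≤f 2≤t arrows))
theorem3p1 {suc (suc (suc i))} {t} F v 2≤f 2≤t {zero} (arrows , _)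
  with () ← 2≤arrows F (K³ t) 2≤f 2≤t arrows
theorem3p1 {suc (suc (suc i))} {t} F v 2≤f 2≤t {suc zero} (arrows , _)
  with s≤s () ← 2≤arrows F (K³ t) 2≤f 2≤t arrows
theorem3p1 {suc (suc (suc i))} {t} F v _ _ {suc (suc j)} (arrows , _) =
  ramsey-< (clone F v) (K³ t) (arrows-clone F v (K³ t) arrows (few-codes {suc j} {3 + i} (P′-bound j i)))
    -- `r ^ f ∸ 1 < r ^ f`, since the power is positive.
    (∸-monoʳ-< {o = 0} (s≤s z≤n) (m^n>0 (2 + j) (3 + i)))
theorem3p1 {suc zero} _ _ (s≤s ())
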